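{- $\langle\vee\forall\rangle\not\le_{\sf m}\langle\forall^\infty\forall\exists\rangle$.
   Context: Quantifiers range over $\omega$. $\exists^\infty n\,\varphi(n)$ means $\forall m\exists n\ge m\,\varphi(n)$ and $\forall^\infty n\,\varphi(n)$ means $\exists m\forall n\ge m\,\varphi(n)$. Formulas considered are $\varphi(\bar x)\equiv\mathsf Q_0n_0\dots\mathsf Q_\ell n_\ell\,\theta(n_0,\dots,n_\ell,\bar x)$ with $\mathsf Q_i\in\{\exists,\forall,\exists^\infty,\forall^\infty\}$ and $\theta$ bounded. The instance $\bar x$ is a tuple of natural numbers and/or total computable functions (computable elements of $\omega^\omega$). Spaces such as $\omega\times\omega^\omega$, $(\omega^\omega)^\omega$, $\omega^{\omega\times\omega}$ are identified with $\omega^\omega$ by computable pairing. Witnesses: for $\alpha\in\omega^\omega$, $\alpha\Vdash\varphi(\bar x)$ ("$\alpha$ is a witness for $\varphi(\bar x)$") is defined by: $\alpha\Vdash\theta(\bar x)$ iff $\alpha=\bar x$ and $\theta(\bar x)$, for bounded $\theta$; $\langle t,\alpha\rangle\Vdash\exists n\varphi(n,\bar x)$ iff $\alpha\Vdash\varphi(t,\bar x)$; $\alpha\Vdash\forall n\varphi(n,\bar x)$ iff $\alpha(n)\Vdash\varphi(n,\bar x)$ for all $n$; $\langle t,\alpha\rangle\Vdash\forall^\infty n\varphi(n,\bar x)$ iff $\alpha(n)\Vdash\varphi(n,\bar x)$ for all $n\ge t$; $\alpha\Vdash\exists^\infty n\varphi(n,\bar x)$ iff for all $n$, writing $\alpha(n)=\langle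 k,\beta\rangle$, $k\ge n$ and $\beta\Vdash\varphi(k,\bar x)$. $\varphi\le_{\sf m}\psi$ if there are computable functions $\eta,r_-,r_+$ (type-two computable functionals, possibly partial but defined wherever required) such that for every instance $\bar x$: $\varphi(\bar x)$ is true iff $\psi(\eta(\bar x))$ is true; $\alpha\Vdash\varphi(\bar x)$ implies $r_-(\alpha,\bar x)\Vdash\psi(\eta(\bar x))$; $\alpha\Vdash\psi(\eta(\bar x))$ implies $r_+(\alpha,\bar x)\Vdash\varphi(\bar x)$ ($\alpha\in\omega^\omega$ arbitrary). $\langle\forall^\infty\forall\exists\rangle$ is a fixed complete formula of its pattern (every formula with that pattern is $\le_{\sf m}$-reducible to it), concretely $\langle\forall^\infty\forall\exists\rangle(x)\equiv\forall^\infty n\,\forall k\,\exists\ell.\ x(n,k,\ell)=0$. The formula $\langle\vee\forall\rangle$ is, for $x=(x_0,x_1)$ with $x_0,x_1\in\omega^\omega$ computable, $x_0=0^\infty\vee x_1=0^\infty$, read as $\exists i\in\{0,1\}\,\forall t.\ x_i(t)=0$; so a witness is essentially an $i\in\{0,1\}$ with $x_i=0^\infty$, where $0^\infty$ is the constantly zero sequence. -}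

module Defs where

open import Data.Nat using (ℕ; zero; suc; _+_; _*_; _≤_; _<_)
open import Data.Fin using (Fin)
open import Data.Fin.Patterns using (0F; 1F; 2F)
open import Data.Vec using (Vec; []; _∷_; lookup)
open import Data.Vec.Relation.Unary.All using (All)
open import Data.Product using (Σ; _×_; _,_)
open import Data.Sum using (_⊎_)
open import Function.Bundles using (_⇔_)
open import Relation.Nullary using (¬_)
open import Relation.Binary.PropositionalEquality using (_≡_; _≗_)

private variable
  k m n p q p′ q′ : ℕ

Baire : Set
Baire = ℕ → ℕ

-- The Cantor pairing function and its inverse.  `unpair` walks along the
-- antidiagonals: (0,0), (0,1), (1,0), (0,2), (1,1), (2,0), …

triangle : ℕ → ℕ
triangle zero    = zero
triangle (suc n) = suc n + triangle n

pair : ℕ → ℕ → ℕ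
pair a b = triangle (a + b) + a

nextPair : ℕ × ℕ → ℕ × ℕ
nextPair (a , zero)  = zero , suc a
nextPair (a , suc b) = suc a , b

unpair : ℕ → ℕ × ℕ
unpair zero    = zero , zero
unpair (suc n) = nextPair (unpair n)

-- ω × ω^ω is identified with ω^ω by putting the number in front, so every α is
-- ⟨ head α , tail α ⟩; (ω^ω)^ω is identified with ω^ω by pairing the indices, so
-- α is the sequence n ↦ row α n.

cons : ℕ → Baire → Baire
cons t α zero    = t
cons t α (suc i) = α i

head : Baire → ℕ
head α = α zero

tail : Baire → Baire
tail α i = α (suc i)

row : Baire → ℕ → Baire
row α n i = α (pair n i)

-- A tuple of numbers and functions as a single element of ω^ω: the numbers come
-- first, followed by ⟨ i , j ⟩ ↦ fᵢ(j), which is 0 when there is no function fᵢ.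

component : Vec Baire q → ℕ → Baire
component []       i       j = zero
component (f ∷ fs) zero    j = f j
component (f ∷ fs) (suc i) j = component fs i j

code : Vec ℕ p → Vec Baire q → Baire
code []       fs i = let (j , l) = unpair i in component fs j l
code (n ∷ ns) fs   = cons n (code ns fs)

-- Partial recursive functions of n numbers relative to k oracles.

data Rec (k : ℕ) : ℕ → Set where
  zer    : Rec k n
  succ   : Rec k 1
  proj   : Fin n → Rec k n
  oracle : Fin k → Rec k 1
  comp   : Rec k m → Vec (Rec k n) m → Rec k n
  prim   : Rec k n → Rec k (suc (suc n)) → Rec k (suc n)
  mu     : Rec k (suc n) → Rec k n

infix 4 _⊢_·_⇓_ _⊢_·_⇓*_

-- O ⊢ e · xs ⇓ v : with oracles O, the program e halts on xs with value v.

mutual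
  data _⊢_·_⇓_ (O : Vec Baire k) : Rec k n → Vec ℕ n → ℕ → Set where
    zer⇓    : {xs : Vec ℕ n} → O ⊢ zer · xs ⇓ zero
    succ⇓   : ∀ {x} → O ⊢ succ · (x ∷ []) ⇓ suc x
    proj⇓   : {i : Fin n} {xs : Vec ℕ n} → O ⊢ proj i · xs ⇓ lookup xs i
    oracle⇓ : ∀ {i x} → O ⊢ oracle i · (x ∷ []) ⇓ lookup O i x
    comp⇓   : {f : Rec k m} {gs : Vec (Rec k n) m}
              {xs : Vec ℕ n} {ys : Vec ℕ m} {v : ℕ} →
              O ⊢ gs · xs ⇓* ys → O ⊢ f · ys ⇓ v → O ⊢ comp f gs · xs ⇓ v
    prim⇓₀  : {f : Rec k n} {g : Rec k (suc (suc n))} {xs : Vec ℕ n} {v : ℕ} →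
              O ⊢ f · xs ⇓ v → O ⊢ prim f g · (zero ∷ xs) ⇓ v
    prim⇓₊  : {f : Rec k n} {g : Rec k (suc (suc n))} {xs : Vec ℕ n} {x u v : ℕ} →
              O ⊢ prim f g · (x ∷ xs) ⇓ u → O ⊢ g · (x ∷ u ∷ xs) ⇓ v →
              O ⊢ prim f g · (suc x ∷ xs) ⇓ v
    mu⇓     : {f : Rec k (suc n)} {xs : Vec ℕ n} {v : ℕ} →
              O ⊢ f · (v ∷ xs) ⇓ zero →
              (∀ i → i < v → Σ ℕ λ u → O ⊢ f · (i ∷ xs) ⇓ suc u) →
              O ⊢ mu f · xs ⇓ v

  data _⊢_·_⇓*_ (O : Vec Baire k) : Vec (Rec k n) m → Vec ℕ n → Vec ℕ m → Set where
    []  : {xs : Vec ℕ n} → O ⊢ [] · xs ⇓* []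
    _∷_ : {g : Rec k n} {gs : Vec (Rec k n) m}
          {xs : Vec ℕ n} {y : ℕ} {ys : Vec ℕ m} →
          O ⊢ g · xs ⇓ y → O ⊢ gs · xs ⇓* ys → O ⊢ g ∷ gs · xs ⇓* (y ∷ ys)

-- A program with k oracles and one numeric input is a partial computable
-- functional from (ω^ω)^k to ω^ω; it is defined at O, with value β, when it
-- halts on every input i with output β i.

Functional : ℕ → Set
Functional k = Rec k 1

infix 4 _$_↝_

_$_↝_ : Functional k → Vec Baire k → Baire → Set
F $ O ↝ β = ∀ i → O ⊢ F · (i ∷ []) ⇓ β i

Computable : Baire → Set
Computable f = Σ (Functional 0) λ e → e $ [] ↝ f

-- Terms and bounded formulas in n number variables (de Bruijn, the most recently
-- bound one being 0) and q function parameters.  Pairing is a term former because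
-- spaces such as ω^(ω×ω) are identified with ω^ω.

data Term (n q : ℕ) : Set where
  var        : Fin n → Term n q
  O          : Term n q
  S          : Term n q → Term n q
  _⊕_ _⊗_ ⟪_,_⟫ : Term n q → Term n q → Term n q
  app        : Fin q → Term n q → Term n q

infix  6 _≐_ _≼_
infix  6 ~_
infixr 5 _∧_
infixr 4 _∨_

data Bounded (n q : ℕ) : Set where
  _≐_ _≼_ : Term n q → Term n q → Bounded n q
  ~_      : Bounded n q → Bounded n q
  _∧_ _∨_ : Bounded n q → Bounded n q → Bounded n q
  ∀< ∃<   : Term n q → Bounded (suc n) q → Bounded n q

⟦_⟧ : Term n q → Vec ℕ n → Vec Baire q → ℕ
⟦ var i ⟧     ns fs = lookup ns i
⟦ O ⟧         ns fs = zero
⟦ S s ⟧       ns fs = suc (⟦ s ⟧ ns fs)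
⟦ s ⊕ t ⟧     ns fs = ⟦ s ⟧ ns fs + ⟦ t ⟧ ns fs
⟦ s ⊗ t ⟧     ns fs = ⟦ s ⟧ ns fs * ⟦ t ⟧ ns fs
⟦ ⟪ s , t ⟫ ⟧ ns fs = pair (⟦ s ⟧ ns fs) (⟦ t ⟧ ns fs)
⟦ app i s ⟧   ns fs = lookup fs i (⟦ s ⟧ ns fs)

Holds : Bounded n q → Vec ℕ n → Vec Baire q → Set
Holds (s ≐ t)  ns fs = ⟦ s ⟧ ns fs ≡ ⟦ t ⟧ ns fs
Holds (s ≼ t)  ns fs = ⟦ s ⟧ ns fs ≤ ⟦ t ⟧ ns fs
Holds (~ θ)    ns fs = ¬ Holds θ ns fs
Holds (θ ∧ χ)  ns fs = Holds θ ns fs × Holds χ ns fs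
Holds (θ ∨ χ)  ns fs = Holds θ ns fs ⊎ Holds χ ns fs
Holds (∀< t θ) ns fs = ∀ i → i < ⟦ t ⟧ ns fs → Holds θ (i ∷ ns) fs
Holds (∃< t θ) ns fs = Σ ℕ λ i → i < ⟦ t ⟧ ns fs × Holds θ (i ∷ ns) fs

data Formula (n q : ℕ) : Set where
  matrix         : Bounded n q → Formula n q
  ∃′ ∀′ ∃∞′ ∀∞′ : Formula (suc n) q → Formula n q

True : Formula n q → Vec ℕ n → Vec Baire q → Set
True (matrix θ) ns fs = Holds θ ns fs
True (∃′ φ)     ns fs = Σ ℕ λ i → True φ (i ∷ ns) fs
True (∀′ φ)     ns fs = ∀ i → True φ (i ∷ ns) fs
True (∃∞′ φ)    ns fs = ∀ j → Σ ℕ λ i → j ≤ i × True φ (i ∷ ns) fs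
True (∀∞′ φ)    ns fs = Σ ℕ λ j → ∀ i → j ≤ i → True φ (i ∷ ns) fs

-- Witness φ ns fs α is α ⊩ φ(ns, fs).

Witness : Formula n q → Vec ℕ n → Vec Baire q → Baire → Set
Witness (matrix θ) ns fs α = α ≗ code ns fs × Holds θ ns fs
Witness (∃′ φ)     ns fs α = Witness φ (head α ∷ ns) fs (tail α)
Witness (∀′ φ)     ns fs α = ∀ i → Witness φ (i ∷ ns) fs (row α i)
Witness (∃∞′ φ)    ns fs α =
  ∀ i → i ≤ head (row α i) × Witness φ (head (row α i) ∷ ns) fs (tail (row α i))
Witness (∀∞′ φ)    ns fs α =
  ∀ i → head α ≤ i → Witness φ (i ∷ ns) fs (row (tail α) i)

record Instance (n q : ℕ) : Set where
  field
    numbers    : Vec ℕ n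
    functions  : Vec Baire q
    computable : All Computable functions

  encoded : Baire
  encoded = code numbers functions

open Instance public

IsTrue : Formula n q → Instance n q → Set
IsTrue φ x = True φ (numbers x) (functions x)

infix 4 _⊩_at_ _≤ₘ_

_⊩_at_ : Baire → Formula n q → Instance n q → Set
α ⊩ φ at x = Witness φ (numbers x) (functions x) α

-- `target x` is the instance η(x).  It is determined by η up to pointwise equality,
-- since `code` is injective and programs are deterministic.

record _≤ₘ_ (φ : Formula p q) (ψ : Formula p′ q′) : Set where
  field
    η       : Functional 1
    r₋ r₊   : Functional 2
    target  : Instance p q → Instance p′ q′
    η-value : ∀ x → η $ encoded x ∷ [] ↝ encoded (target x)
    truth   : ∀ x → IsTrue φ x ⇔ IsTrue ψ (target x)
    forth   : ∀ x α → α ⊩ φ at x →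
              Σ Baire λ β → r₋ $ α ∷ encoded x ∷ [] ↝ β × β ⊩ ψ at target x
    back    : ∀ x α → α ⊩ ψ at target x →
              Σ Baire λ β → r₊ $ α ∷ encoded x ∷ [] ↝ β × β ⊩ φ at x

-- ∃ i ∈ {0,1} ∀ t. xᵢ(t) = 0, where i is var 1F and t is var 0F; the bound on i and
-- the choice of xᵢ are expressed in the matrix.

⟨∨∀⟩ : Formula 0 2
⟨∨∀⟩ = ∃′ (∀′ (matrix
  (  var 1F ≐ O   ∧ app 0F (var 0F) ≐ O
   ∨ var 1F ≐ S O ∧ app 1F (var 0F) ≐ O)))

⟨∀∞∀∃⟩ : Formula 0 1
⟨∀∞∀∃⟩ = ∀∞′ (∀′ (∃′ (matrix
  (app 0F ⟪ var 2F , ⟪ var 1F , var 0F ⟫ ⟫ ≐ O))))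

{-# OPTIONS --safe #-}

-- Feed the reduction (0^∞, 0^∞).  By continuity of r₋, the thresholds t₀ and t₁ which it
-- computes from the two witnesses 0 and 1 persist for all instances close to (0^∞, 0^∞).
-- Hence t = max(t₀, t₁) is a valid threshold for η(x₀, x₁) as soon as (x₀, x₁) is close to
-- (0^∞, 0^∞) and at least one of x₀ and x₁ is 0^∞.  Take a witness α of η(0^∞, 0^∞) with
-- threshold t.  The number i that r₊ extracts from α depends on a finite part of α only, and
-- this part extends to a witness with threshold t for both η(0^∞, 0^s 1^∞) and
-- η(0^s 1^∞, 0^∞), when s is large.  So i would have to be both 0 and 1.

module Submission where

open import Defs
open import Data.Fin using (Fin; toℕ)
open import Data.Fin.Patterns using (0F; 1F)
open import Data.Nat
  using (ℕ; zero; suc; _+_; _⊔_; _≤_; _<_; _≟_; z≤n; s≤s; s≤s⁻¹)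
open import Data.Nat.Properties
open import Data.Product using (Σ; ∃; _×_; _,_; proj₁; proj₂)
open import Data.Sum using (_⊎_; inj₁; inj₂)
open import Data.Vec using (Vec; []; _∷_; lookup)
open import Data.Vec.Relation.Binary.Pointwise.Inductive as Pointwise
  using (Pointwise; []; _∷_)
open import Data.Vec.Relation.Unary.All using ([]; _∷_)
open import Function.Base using (const)
open import Relation.Binary.Definitions using (tri<; tri≈; tri>)
open import Relation.Binary.PropositionalEquality
  using (_≡_; _≗_; refl; sym; trans; cong; cong₂; subst)
open import Relation.Nullary using (¬_; yes; no; contradiction)

private variable
  k m n q : ℕ

-- Inverting the pairing function.

unpair-pair : ∀ a b → unpair (pair a b) ≡ (a , b)
unpair-pair a b = go (a + b) a b refl
  where
  go : ∀ d a b → a + b ≡ d → unpair (triangle d + a) ≡ (a , b)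
  go zero    zero    zero    eq = refl
  -- The walk enters a new antidiagonal from the last point `(d , 0)` of the previous one; within an
  -- antidiagonal, `(suc a , b)` follows `(a , suc b)`.
  go (suc d) zero    (suc b) eq =
    trans (cong unpair (trans (+-identityʳ _) (cong suc (+-comm d _))))
      (trans (cong nextPair (go d d zero (+-identityʳ d)))
        (cong (λ c → zero , c) (sym eq)))
  go (suc d) (suc a) b       eq =
    trans (cong unpair (+-suc (triangle (suc d)) a))
      (cong nextPair (go (suc d) a (suc b) (trans (+-suc a b) eq)))

unpair-≤ : ∀ i → proj₁ (unpair i) + proj₂ (unpair i) ≤ i
unpair-≤ zero = z≤n
unpair-≤ (suc i) with unpair i | unpair-≤ i
... | a , zero  | le = s≤s (≤-trans (m≤m+n a zero) le)
... | a , suc b | le = s≤s (≤-trans (+-monoʳ-≤ a (n≤1+n b)) le)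

-- Position `i` of a paired sequence reads its inner sequence at or below `i`, so agreement below a
-- bound carries over.
unpair₂-≤ : ∀ i → proj₂ (unpair i) ≤ i
unpair₂-≤ i = ≤-trans (m≤n+m _ (proj₁ (unpair i))) (unpair-≤ i)

-- Continuity of computations with oracles.

infix 4 _≈[_]_

record _≈[_]_ (α : Baire) (M : ℕ) (β : Baire) : Set where
  constructor below
  field
    at : ∀ i → i < M → α i ≡ β i

open _≈[_]_

≈-antitone : ∀ {α β M N} → M ≤ N → α ≈[ N ] β → α ≈[ M ] β
≈-antitone M≤N eq .at i i<M = eq .at i (<-≤-trans i<M M≤N)

≈-refl : ∀ {α M} → α ≈[ M ] α
≈-refl .at _ _ = refl

cons-≈ : ∀ {α β M a b} → a ≡ b → α ≈[ M ] β → cons a α ≈[ M ] cons b β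
cons-≈ a≡b eq .at zero    _   = a≡b
cons-≈ a≡b eq .at (suc i) i<M = eq .at i (<-trans (n<1+n i) i<M)

Agree : ℕ → Vec Baire k → Vec Baire k → Set
Agree M = Pointwise _≈[ M ]_

-- `P` holds on a basic open neighbourhood of `Ω` in the product topology.
Eventually : Vec Baire k → (Vec Baire k → Set) → Set
Eventually Ω P = ∃ λ M → ∀ Ω′ → Agree M Ω Ω′ → P Ω′

module _ {Ω : Vec Baire k} where

  eventually-× : ∀ {P Q} → Eventually Ω P → Eventually Ω Q → Eventually Ω (λ Ω′ → P Ω′ × Q Ω′)
  eventually-× (M , p) (N , q) = M ⊔ N , λ Ω′ agree →
    p Ω′ (Pointwise.map (≈-antitone (m≤m⊔n M N)) agree) ,
    q Ω′ (Pointwise.map (≈-antitone (m≤n⊔m M N)) agree)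

  eventually-map : ∀ {P Q} → (∀ {Ω′} → P Ω′ → Q Ω′) → Eventually Ω P → Eventually Ω Q
  eventually-map f (M , p) = M , λ Ω′ agree → f (p Ω′ agree)

  eventually-∀< : ∀ {P : ℕ → Vec Baire k → Set} v → (∀ i → i < v → Eventually Ω (P i)) →
                  Eventually Ω (λ Ω′ → ∀ i → i < v → P i Ω′)
  eventually-∀< zero    ps = zero , λ _ _ _ ()
  eventually-∀< {P} (suc v) ps =
    eventually-map extend
      (eventually-× (eventually-∀< v (λ i i<v → ps i (m<n⇒m<1+n i<v))) (ps v (n<1+n v)))
    where
    extend : ∀ {Ω′} → (∀ i → i < v → P i Ω′) × P v Ω′ → ∀ i → i < suc v → P i Ω′
    extend (rest , top) i i<1+v with m≤n⇒m<n∨m≡n (s≤s⁻¹ i<1+v)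
    ... | inj₁ i<v  = rest i i<v
    ... | inj₂ refl = top

  -- Determinism is the case Ω′ = Ω; the mu case needs it together with continuity.
  continuous : ∀ {e : Rec k n} {xs v} → Ω ⊢ e · xs ⇓ v →
               Eventually Ω (λ Ω′ → ∀ {v′} → Ω′ ⊢ e · xs ⇓ v′ → v ≡ v′)
  continuous* : ∀ {gs : Vec (Rec k n) m} {xs vs} → Ω ⊢ gs · xs ⇓* vs →
                Eventually Ω (λ Ω′ → ∀ {vs′} → Ω′ ⊢ gs · xs ⇓* vs′ → vs ≡ vs′)

  continuous zer⇓  = zero , λ { _ _ zer⇓ → refl }
  continuous succ⇓ = zero , λ { _ _ succ⇓ → refl }
  continuous proj⇓ = zero , λ { _ _ proj⇓ → refl }
  continuous (oracle⇓ {i} {x}) =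
    suc x , λ { _ agree oracle⇓ → Pointwise.lookup agree i .at x (n<1+n x) }
  continuous (comp⇓ ds d) =
    eventually-map (λ { (same* , same) (comp⇓ ds′ d′) → lemma same (same* ds′) d′ })
      (eventually-× (continuous* ds) (continuous d))
    where
    lemma : ∀ {Ω′ : Vec Baire k} {f : Rec k m} {ys ys′ v v′} →
            (∀ {w} → Ω′ ⊢ f · ys ⇓ w → v ≡ w) → ys ≡ ys′ → Ω′ ⊢ f · ys′ ⇓ v′ → v ≡ v′
    lemma same refl d′ = same d′
  continuous (prim⇓₀ d) =
    eventually-map (λ { same (prim⇓₀ d′) → same d′ }) (continuous d)
  continuous (prim⇓₊ d₁ d₂) =
    eventually-map (λ { (same₁ , same₂) (prim⇓₊ d₁′ d₂′) → lemma same₂ (same₁ d₁′) d₂′ })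
      (eventually-× (continuous d₁) (continuous d₂))
    where
    lemma : ∀ {Ω′ : Vec Baire k} {g : Rec k (suc (suc n))} {x u u′ xs v v′} →
            (∀ {w} → Ω′ ⊢ g · (x ∷ u ∷ xs) ⇓ w → v ≡ w) → u ≡ u′ →
            Ω′ ⊢ g · (x ∷ u′ ∷ xs) ⇓ v′ → v ≡ v′
    lemma same refl d′ = same d′
  continuous (mu⇓ {f = f} {xs} {v} d ds) =
    eventually-map (λ { (same , sames) (mu⇓ d′ ds′) → lemma same sames d′ ds′ })
      (eventually-× (continuous d)
        (eventually-∀< {P = P} v (λ i i<v → positive (continuous (proj₂ (ds i i<v))))))
    where
    P : ℕ → Vec Baire k → Set
    P i Ω′ = ¬ Ω′ ⊢ f · (i ∷ xs) ⇓ zero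

    positive : ∀ {i u} → Eventually Ω (λ Ω′ → ∀ {w} → Ω′ ⊢ f · (i ∷ xs) ⇓ w → suc u ≡ w) →
               Eventually Ω (P i)
    positive = eventually-map (λ same d′ → 1+n≢0 (same d′))

    lemma : ∀ {Ω′ v′} → (∀ {w} → Ω′ ⊢ f · (v ∷ xs) ⇓ w → zero ≡ w) → (∀ i → i < v → P i Ω′) →
            Ω′ ⊢ f · (v′ ∷ xs) ⇓ zero →
            (∀ i → i < v′ → Σ ℕ λ u → Ω′ ⊢ f · (i ∷ xs) ⇓ suc u) → v ≡ v′
    -- A larger `v′` would need a positive value at `v`, a smaller one a zero below `v`; near `Ω`
    -- neither occurs.
    lemma {v′ = v′} same sames d′ ds′ with <-cmp v v′
    ... | tri< v<v′ _ _ = contradiction (same (proj₂ (ds′ v v<v′))) 0≢1+n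
    ... | tri≈ _ v≡v′ _ = v≡v′
    ... | tri> _ _ v′<v = contradiction d′ (sames v′ v′<v)

  continuous* []       = zero , λ { _ _ [] → refl }
  continuous* (d ∷ ds) =
    eventually-map (λ { (same , same*) (d′ ∷ ds′) → cong₂ _∷_ (same d′) (same* ds′) })
      (eventually-× (continuous d) (continuous* ds))

functional-continuous : ∀ {F : Functional k} {Ω β} → F $ Ω ↝ β → ∀ N →
  Eventually Ω (λ Ω′ → ∀ {β′} → F $ Ω′ ↝ β′ → β ≈[ N ] β′)
functional-continuous {F = F} {Ω} {β} F↝ N =
  let (M , same) = eventually-∀< {P = Same} N (λ i _ → continuous (F↝ i))
  in M , λ Ω′ agree F↝′ → below λ i i<N → same Ω′ agree i i<N (F↝′ i)
  where
  Same : ℕ → Vec Baire _ → Set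
  Same i Ω′ = ∀ {v′} → Ω′ ⊢ F · (i ∷ []) ⇓ v′ → β i ≡ v′

-- Instances near the origin and their witnesses.

-- 0^s 1^∞
step : ℕ → Baire
step zero    i       = 1
step (suc s) zero    = 0
step (suc s) (suc i) = step s i

step-≈ : ∀ s → const 0 ≈[ s ] step s
step-≈ (suc s) .at zero    _   = refl
step-≈ (suc s) .at (suc i) i<s = step-≈ s .at i (s≤s⁻¹ i<s)

step-≢0 : ∀ s → ¬ step s s ≡ 0
step-≢0 (suc s) eq = step-≢0 s eq

zeros-computable : Computable (const 0)
zeros-computable = zer , λ _ → zer⇓

step-computable : ∀ s → Computable (step s)
step-computable zero    = comp succ (zer ∷ []) , λ _ → comp⇓ (zer⇓ ∷ []) succ⇓
step-computable (suc s) with step-computable s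
-- Primitive recursion serves only as a case split: the recursive value is ignored.
... | e , e↝ = prim zer (comp e (proj 0F ∷ [])) , halts
  where
  halts : prim zer (comp e (proj 0F ∷ [])) $ [] ↝ step (suc s)
  halts zero    = prim⇓₀ zer⇓
  halts (suc i) = prim⇓₊ (halts i) (comp⇓ (proj⇓ ∷ []) (e↝ i))

origin : Instance 0 2
origin = record
  { numbers    = []
  ; functions  = const 0 ∷ const 0 ∷ []
  ; computable = zeros-computable ∷ zeros-computable ∷ []
  }

-- The instance near the origin for which only i is a correct answer.
only : Fin 2 → ℕ → Instance 0 2
only 0F s = record
  { numbers    = []
  ; functions  = const 0 ∷ step s ∷ []
  ; computable = zeros-computable ∷ step-computable s ∷ []
  }
only 1F s = record
  { numbers    = []
  ; functions  = step s ∷ const 0 ∷ []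
  ; computable = step-computable s ∷ zeros-computable ∷ []
  }

component-≈ : ∀ {s} {fs gs : Vec Baire q} → Agree s fs gs →
              ∀ j → component fs j ≈[ s ] component gs j
component-≈ []           j       = ≈-refl
component-≈ (eq ∷ agree) zero    = eq
component-≈ (eq ∷ agree) (suc j) = component-≈ agree j

code-≈ : ∀ {s} {fs gs : Vec Baire q} → Agree s fs gs → code [] fs ≈[ s ] code [] gs
code-≈ agree .at i i<s =
  component-≈ agree (proj₁ (unpair i)) .at _ (≤-<-trans (unpair₂-≤ i) i<s)

only-≈ : ∀ i s → encoded origin ≈[ s ] encoded (only i s)
only-≈ 0F s = code-≈ (≈-refl ∷ step-≈ s ∷ [])
only-≈ 1F s = code-≈ (step-≈ s ∷ ≈-refl ∷ [])

-- A witness of the matrix must repeat the instance together with the bound numbers, so row `t` is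
-- the code with `t` and `i` in front.
answer : ℕ → Instance 0 2 → Baire
answer i x = cons i λ p →
  code (proj₁ (unpair p) ∷ i ∷ numbers x) (functions x) (proj₂ (unpair p))

answer-⊩ : ∀ i x → lookup (functions x) i ≗ const 0 → answer (toℕ i) x ⊩ ⟨∨∀⟩ at x
answer-⊩ i x xᵢ≗0 t =
  (λ r → cong (λ (t , r) → code (t ∷ toℕ i ∷ numbers x) (functions x) r) (unpair-pair t r)) ,
  correct i (xᵢ≗0 t)
  where
  correct : ∀ i → lookup (functions x) i t ≡ 0 →
            (toℕ i ≡ 0 × lookup (functions x) 0F t ≡ 0) ⊎
            (toℕ i ≡ 1 × lookup (functions x) 1F t ≡ 0)
  correct 0F eq = inj₁ (refl , eq)
  correct 1F eq = inj₂ (refl , eq)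

answer-≈ : ∀ i x y {N} → encoded x ≈[ N ] encoded y → answer i x ≈[ N ] answer i y
answer-≈ i x y x≈y = cons-≈ refl (below λ p p<N →
  cons-≈ refl (cons-≈ refl x≈y) .at _ (≤-<-trans (unpair₂-≤ p) p<N))

only-answer : ∀ i s → answer (toℕ i) (only i s) ⊩ ⟨∨∀⟩ at only i s
only-answer 0F s = answer-⊩ 0F (only 0F s) (λ _ → refl)
only-answer 1F s = answer-⊩ 1F (only 1F s) (λ _ → refl)

origin-answer : ∀ (i : Fin 2) → answer (toℕ i) origin ⊩ ⟨∨∀⟩ at origin
origin-answer 0F = answer-⊩ 0F origin (λ _ → refl)
origin-answer 1F = answer-⊩ 1F origin (λ _ → refl)

-- Row `s` of `γ` asserts that the chosen function vanishes at `s`, where `step s` does not.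
only-head : ∀ i s γ → γ ⊩ ⟨∨∀⟩ at only i s → head γ ≡ toℕ i
only-head 0F s γ w with proj₂ (w s)
... | inj₁ (eq , _) = eq
... | inj₂ (_ , eq) = contradiction eq (step-≢0 s)
only-head 1F s γ w with proj₂ (w s)
... | inj₁ (_ , eq) = contradiction eq (step-≢0 s)
... | inj₂ (eq , _) = eq

-- Witnesses of `⟨∀∞∀∃⟩` as Skolem functions.

value : Instance 0 1 → ℕ → ℕ → ℕ → ℕ
value y n k l = lookup (functions y) 0F (pair n (pair k l))

index : ℕ → ℕ → ℕ → ℕ
index n k l = pair 0 (pair n (pair k l))

encoded-index : ∀ y n k l → encoded y (index n k l) ≡ value y n k l
encoded-index y n k l = at-code (numbers y) (functions y) (pair n (pair k l))
  where
  -- Stated for arbitrary vectors, so that their lengths force the shapes `[]` and `f ∷ []`.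
  at-code : ∀ (ns : Vec ℕ 0) (fs : Vec Baire 1) p → code ns fs (pair 0 p) ≡ lookup fs 0F p
  at-code [] (f ∷ []) p rewrite unpair-pair 0 p = refl

Solves : Instance 0 1 → ℕ → (ℕ → ℕ → ℕ) → Set
Solves y t L = ∀ n → t ≤ n → ∀ k → value y n k (L n k) ≡ 0

solution : Baire → ℕ → ℕ → ℕ
solution α n k = head (row (row (tail α) n) k)

-- Raising the threshold of a witness only discards requirements.
⊩-solves : ∀ α y {t} → head α ≤ t → α ⊩ ⟨∀∞∀∃⟩ at y → Solves y t (solution α)
⊩-solves α y α≤t w n t≤n k = proj₂ (w n (≤-trans α≤t t≤n) k)

cell : Instance 0 1 → (ℕ → ℕ → ℕ) → ℕ → ℕ → Baire
cell y L n k = cons (L n k) (code (L n k ∷ k ∷ n ∷ numbers y) (functions y))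

witness : Instance 0 1 → ℕ → (ℕ → ℕ → ℕ) → Baire
witness y t L = cons t λ p →
  let (n , q) = unpair p ; (k , r) = unpair q in cell y L n k r

witness-row : ∀ y t L n k → row (row (tail (witness y t L)) n) k ≗ cell y L n k
witness-row y t L n k r rewrite unpair-pair n (pair k r) | unpair-pair k r = refl

witness-⊩ : ∀ y {t L} → Solves y t L → witness y t L ⊩ ⟨∀∞∀∃⟩ at y
witness-⊩ y {t} {L} solves n t≤n k
  rewrite witness-row y t L n k 0 =
    (λ r → witness-row y t L n k (suc r)) , solves n t≤n k

-- Keeps the entries of L that look the same for y and y′, even below the threshold, so that
-- the witnesses built from the two solutions agree on finite parts.
repair : Instance 0 1 → Instance 0 1 → (L L′ : ℕ → ℕ → ℕ) → ℕ → ℕ → ℕ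
repair y y′ L L′ n k with value y n k (L n k) ≟ value y′ n k (L n k)
... | yes _ = L n k
... | no  _ = L′ n k

-- From `t` on, a kept entry is a zero for `y` and hence for `y′`; a replaced one is a zero by
-- `solves′`.
repair-solves : ∀ y y′ {t L L′} → Solves y t L → Solves y′ t L′ →
                Solves y′ t (repair y y′ L L′)
repair-solves y y′ {L = L} solves solves′ n t≤n k
  with value y n k (L n k) ≟ value y′ n k (L n k)
... | yes eq = trans (sym eq) (solves n t≤n k)
... | no  _  = solves′ n t≤n k

repair-kept : ∀ y y′ L L′ {n k} → value y n k (L n k) ≡ value y′ n k (L n k) →
              L n k ≡ repair y y′ L L′ n k
repair-kept y y′ L L′ {n} {k} eq with value y n k (L n k) ≟ value y′ n k (L n k)
... | yes _ = refl
... | no ¬eq = contradiction eq ¬eq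

-- The first `M` entries involve finitely many choices `L n k`; once `y′` agrees with `y` at the
-- positions these query, `repair` keeps them, whatever `L′` is.
witness-continuous : ∀ y t L M → ∃ λ N → ∀ y′ L′ → encoded y ≈[ N ] encoded y′ →
                     witness y t L ≈[ M ] witness y′ t (repair y y′ L L′)
witness-continuous y t L M =
  let (N , same) = eventually-∀< {Ω = encoded y ∷ []} {P = Unchanged} M unchanged in
  -- `N` covers the queried positions, `M` the copies of the instance inside the cells.
  N ⊔ M , λ y′ L′ y≈y′ → cons-≈ refl (below λ p p<M →
    let (n , q) = unpair p
        (k , r) = unpair q
        kept : L n k ≡ repair y y′ L L′ n k
        kept = repair-kept y y′ L L′
          (trans (sym (encoded-index y n k _))
            (trans (same (encoded y′ ∷ []) (≈-antitone (m≤m⊔n N M) y≈y′ ∷ []) p p<M)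
              (encoded-index y′ n k _)))
    in cons-≈ kept (cons-≈ kept (cons-≈ refl (cons-≈ refl (≈-antitone (m≤n⊔m N M) y≈y′)))) .at r
         (≤-<-trans (≤-trans (unpair₂-≤ q) (unpair₂-≤ p)) p<M))
  where
  query : ℕ → ℕ
  query p = let (n , q) = unpair p ; (k , _) = unpair q in index n k (L n k)

  Unchanged : ℕ → Vec Baire 1 → Set
  Unchanged p Ω = encoded y (query p) ≡ lookup Ω 0F (query p)

  unchanged : ∀ p → p < M → Eventually (encoded y ∷ []) (Unchanged p)
  unchanged p _ =
    suc (query p) , λ _ agree → Pointwise.lookup agree 0F .at (query p) (n<1+n _)

-- Refuting a reduction.

module _ (reduction : ⟨∨∀⟩ ≤ₘ ⟨∀∞∀∃⟩) where
  open _≤ₘ_ reduction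

  originForth : ∀ i → Σ Baire λ β →
    r₋ $ answer (toℕ i) origin ∷ encoded origin ∷ [] ↝ β × β ⊩ ⟨∀∞∀∃⟩ at target origin
  originForth i = forth origin (answer (toℕ i) origin) (origin-answer i)

  threshold : Fin 2 → ℕ
  threshold i = head (proj₁ (originForth i))

  t : ℕ
  t = threshold 0F ⊔ threshold 1F

  threshold≤t : ∀ i → threshold i ≤ t
  threshold≤t 0F = m≤m⊔n _ _
  threshold≤t 1F = m≤n⊔m (threshold 0F) _

  -- The threshold is the first output of `r₋`, and both inputs tend to those at the origin as `s`
  -- grows.
  threshold-persists : ∀ i → ∃ λ N → ∀ {s} → N ≤ s → ∀ {β} →
    r₋ $ answer (toℕ i) (only i s) ∷ encoded (only i s) ∷ [] ↝ β → threshold i ≡ head β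
  threshold-persists i =
    let (N , same) = functional-continuous (proj₁ (proj₂ (originForth i))) 1
    in N , λ {s} N≤s r₋↝ →
      let near = ≈-antitone N≤s (only-≈ i s)
      in same _ (answer-≈ (toℕ i) origin (only i s) near ∷ near ∷ []) r₋↝ .at 0 (n<1+n 0)

  L : ℕ → ℕ → ℕ
  L = solution (proj₁ (originForth 0F))

  L-solves : Solves (target origin) t L
  L-solves = ⊩-solves (proj₁ (originForth 0F)) (target origin)
    (threshold≤t 0F) (proj₂ (proj₂ (originForth 0F)))

  α : Baire
  α = witness (target origin) t L

  originBack : Σ Baire λ γ →
    r₊ $ α ∷ encoded origin ∷ [] ↝ γ × γ ⊩ ⟨∨∀⟩ at origin
  originBack = back origin α (witness-⊩ (target origin) L-solves)

  -- The left side does not depend on `i`, so the two cases contradict each other.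
  back-head : ∀ i → head (proj₁ originBack) ≡ toℕ i
  back-head i =
    let (A , r₊-same)      = functional-continuous (proj₁ (proj₂ originBack)) 1
        (B , witness-same) = witness-continuous (target origin) t L A
        (C , η-same)       = functional-continuous (η-value origin) B
        (D , r₋-same)      = threshold-persists i
        -- `A` brings the instance close enough for `r₊`, `C` brings the targets into agreement
        -- below `B`, and `D` makes the threshold persist.
        s                  = A ⊔ (C ⊔ D)
        x                  = only i s
        C⊔D≤s              = m≤n⊔m A (C ⊔ D)
        (β , r₋↝ , β-⊩)    = forth x (answer (toℕ i) x) (only-answer i s)
        -- The threshold of `β` equals `threshold i`, so `β` solves the new target from `t` on.
        β≤t                = subst (_≤ t)
          (r₋-same {s} (≤-trans (m≤n⊔m C D) C⊔D≤s) r₋↝) (threshold≤t i)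
        target≈            = η-same (encoded x ∷ [])
          (≈-antitone (≤-trans (m≤m⊔n C D) C⊔D≤s) (only-≈ i s) ∷ []) (η-value x)
        L′                 = repair (target origin) (target x) L (solution β)
        (γ , r₊↝ , γ-⊩)    = back x (witness (target x) t L′)
          (witness-⊩ (target x) (repair-solves (target origin) (target x) L-solves
            (⊩-solves β (target x) β≤t β-⊩)))
        agree              = witness-same (target x) (solution β) target≈ ∷
          ≈-antitone (m≤m⊔n A (C ⊔ D)) (only-≈ i s) ∷ []
    in trans (r₊-same _ agree r₊↝ .at 0 (n<1+n 0)) (only-head i s γ γ-⊩)

proposition4p10 : ¬ (⟨∨∀⟩ ≤ₘ ⟨∀∞∀∃⟩)
proposition4p10 reduction = 0≢1+n (trans (sym (back-head reduction 0F)) (back-head reduction 1F))
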